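{- There exists a constant $c>0$ such that for every integer $n\geq 1$, every $N\times N$ real matrix with $N\geq 2^{cn^{4}(\log n)^2}$ contains an $n\times n$ monotone submatrix. Equivalently, $M_2(n)\leq 2^{cn^{4}(\log n)^2}$ for all $n\geq 1$.
   Context: An $n\times n$ submatrix of a real matrix $A$ is obtained by choosing row indices $i_1<\dots<i_n$ and column indices $j_1<\dots<j_n$ and taking the matrix $B(k,l)=A(i_k,j_l)$. A finite sequence of reals is monotone if it is non-decreasing or non-increasing. A matrix is monotone if (i) every row is monotone, and either all rows are non-decreasing or all rows are non-increasing, and (ii) every column is monotone, and either all columns are non-decreasing or all columns are non-increasing. $M_2(n)$ denotes the smallest $N$ such that every $N\times N$ real matrix contains an $n\times n$ monotone submatrix. -}

module Defs where

open import Level using (Level)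
open import Data.Nat using (ℕ)
open import Data.Fin using (Fin) renaming (_<_ to _<ᶠ_; _≤_ to _≤ᶠ_)
open import Data.Product using (Σ; _×_)
open import Data.Sum using (_⊎_)
open import Relation.Binary.Bundles using (TotalOrder)

-- Entries of matrices live in an arbitrary total order T (the paper uses ℝ;
-- only the order of entries matters).
module _ {a ℓ₁ ℓ₂ : Level} (T : TotalOrder a ℓ₁ ℓ₂) where
  open TotalOrder T renaming (Carrier to A)

  Matrix : ℕ → ℕ → Set a
  Matrix m n = Fin m → Fin n → A

  NonDecreasing : {n : ℕ} → (Fin n → A) → Set _
  NonDecreasing {n} f = ∀ (i j : Fin n) → i ≤ᶠ j → f i ≤ f j

  NonIncreasing : {n : ℕ} → (Fin n → A) → Set _
  NonIncreasing {n} f = ∀ (i j : Fin n) → i ≤ᶠ j → f j ≤ f i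

  MonotoneSeq : {n : ℕ} → (Fin n → A) → Set _
  MonotoneSeq f = NonDecreasing f ⊎ NonIncreasing f

  MonotoneMatrix : {m n : ℕ} → Matrix m n → Set _
  MonotoneMatrix {m} {n} B =
      ( (∀ (i : Fin m) → MonotoneSeq (λ j → B i j))
      × ((∀ (i : Fin m) → NonDecreasing (λ j → B i j))
         ⊎ (∀ (i : Fin m) → NonIncreasing (λ j → B i j))) )
    × ( (∀ (j : Fin n) → MonotoneSeq (λ i → B i j))
      × ((∀ (j : Fin n) → NonDecreasing (λ i → B i j))
         ⊎ (∀ (j : Fin n) → NonIncreasing (λ i → B i j))) )

  StrictlyIncreasing : {n N : ℕ} → (Fin n → Fin N) → Set
  StrictlyIncreasing {n} r = ∀ (k l : Fin n) → k <ᶠ l → r k <ᶠ r l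

  HasMonotoneSubmatrix : {N M : ℕ} → ℕ → Matrix N M → Set _
  HasMonotoneSubmatrix {N} {M} n A =
    Σ (Fin n → Fin N) λ r → Σ (Fin n → Fin M) λ s →
      StrictlyIncreasing r × StrictlyIncreasing s
      × MonotoneMatrix (λ k l → A (r k) (s l))

{-# OPTIONS --safe #-}

-- Let q = 2 ^ ⌈log₂ n⌉ and m = 4 q².  Every column is monotone on some m of the first 4 ^ m rows,
-- so by pigeonhole one set of m rows serves a positive proportion of the columns, all in the same
-- direction.  On m rows, halving at medians once per row splits any set of columns into two parts,
-- of proportion 2 ^ -(m + 1) each, such that in every row one part lies entirely above the other.
-- Iterating gives a binary tree on columns whose nodes carry sign vectors in {±} ^ m.
-- A counting argument in the style of Sauer and Shelah finds in a tree of height O(m d) a subtree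
-- with d branching levels in which nodes of the same level carry the same vector (a pigeonhole
-- argument level by level would need height O(m d²)).  For d of order (log n)² the signs of a given
-- row on a random choice of log₂ q of these levels agree with probability at least 1 / (2 q).  As
-- one of the two signs accounts for half of this, some choice is constant on m / (4 q) = q rows, and
-- these rows are monotone on the q leaves that branch at the chosen levels only.

module Submission where

open import Defs
open import Level using (0ℓ)
open import Data.Nat using (ℕ; _≤_; _<_; _*_; _^_)
open import Data.Nat.Logarithm using (⌈log₂_⌉)
open import Data.Product using (Σ; _×_)
open import Relation.Binary.Bundles using (TotalOrder)

open import Data.Bool using (Bool; true; false; not; T; _∧_; _∨_; if_then_else_)
open import Data.Bool.Properties using (T?; ∧-conicalˡ; ∧-conicalʳ) renaming (_≟_ to _≟ᵇ_)
open import Data.Fin using (Fin; zero; suc; inject≤; fromℕ<; finToFun; funToFin) renaming (_<_ to _<ᶠ_)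
import Data.Fin.Properties as Fin
open import Data.List as List using (List; []; _∷_; _++_; length; map; filter; take; drop; allFin)
open import Data.List.Membership.Propositional using (_∈_)
open import Data.List.Membership.Propositional.Properties
  using (∈-++⁺ˡ; ∈-++⁺ʳ; ∈-++⁻; ∈-map⁺; ∈-lookup)
open import Data.List.Properties
  using (length-++; length-map; length-take; length-drop; length-tabulate; take++drop≡id)
open import Data.List.Relation.Binary.Permutation.Propositional
  using (_↭_; prep; swap; ↭-refl; ↭-sym; ↭-trans; ↭⇒↭ₛ)
open import Data.List.Relation.Binary.Permutation.Propositional.Properties
  using (∈-resp-↭; All-resp-↭; ↭-length)
import Data.List.Relation.Binary.Permutation.Setoid.Properties as Permₛ
open import Data.List.Relation.Binary.Sublist.Propositional
  using (_⊆_; []; _∷_; _∷ʳ_; ⊆-trans; ⊆-refl; minimum)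
open import Data.List.Relation.Binary.Sublist.Propositional.Properties
  using (All-resp-⊆; filter-⊆; take-⊆)
open import Data.List.Relation.Unary.All as All using (All; []; _∷_)
open import Data.List.Relation.Unary.All.Properties using (all-filter)
open import Data.List.Relation.Unary.AllPairs as AllPairs using (AllPairs; []; _∷_)
import Data.List.Relation.Unary.AllPairs.Properties as AllPairsₚ
open import Data.List.Relation.Unary.Any using (here; there)
open import Data.List.Relation.Unary.Unique.Propositional using (Unique)
open import Data.List.Relation.Unary.Unique.Propositional.Properties using (allFin⁺)
open import Data.Maybe using (Maybe; just; nothing)
open import Data.Nat
  using (zero; suc; pred; _+_; _∸_; _⊓_; ⌊_/2⌋; ⌈_/2⌉; NonZero; >-nonZero; >-nonZero⁻¹; z≤n; s≤s; z<s)
open import Data.Nat.Induction using (<-rec)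
open import Data.Nat.ListAction using (sum)
open import Data.Nat.Logarithm using (⌈log₂⌉-mono-≤; ⌈log₂⌈n/2⌉⌉≡⌈log₂n⌉∸1; ⌈log₂2^n⌉≡n)
open import Data.Nat.Properties
open import Data.Nat.Tactic.RingSolver using (solve-∀)
open import Data.Product using (∃; ∃₂; _,_; proj₁; proj₂)
open import Data.Sum using (_⊎_; inj₁; inj₂; [_,_]′)
open import Data.Vec using (Vec; []; _∷_; lookup)
open import Data.Vec.Properties using (≡-dec)
open import Function using (_∘_)
open import Relation.Binary using (DecidableEquality; Total; Transitive)
open import Relation.Binary.PropositionalEquality
open import Relation.Nullary using (does; yes; no; contradiction)
open import Relation.Nullary.Decidable using (dec-true)

private
  variable
    X C : Set

-- Arithmetic and finite sums.

<-split : ∀ {a b c d} → a + b < c + d → a < c ⊎ b < d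
<-split {a} {b} {c} {d} lt with <-≤-connex a c
... | inj₁ a<c = inj₁ a<c
... | inj₂ c≤a with <-≤-connex b d
...   | inj₁ b<d = inj₂ b<d
...   | inj₂ d≤b = contradiction lt (≤⇒≯ (+-mono-≤ c≤a d≤b))

^-distribʳ-* : ∀ k m n → (m * n) ^ k ≡ m ^ k * n ^ k
^-distribʳ-* zero    m n = refl
^-distribʳ-* (suc k) m n = trans (cong (m * n *_) (^-distribʳ-* k m n)) (shuffle m n (m ^ k) (n ^ k))
  where
  shuffle : ∀ m n x y → m * n * (x * y) ≡ m * x * (n * y)
  shuffle = solve-∀

+-interchange : ∀ a b c d → a + b + (c + d) ≡ a + c + (b + d)
+-interchange = solve-∀

∑ : List X → (X → ℕ) → ℕ
∑ xs f = sum (map f xs)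

∑-heavy : ∀ (xs : List X) {f B} → length xs * B < ∑ xs f → ∃ λ x → B < f x
∑-heavy (x ∷ xs) lt with <-split lt
... | inj₁ B<fx = x , B<fx
... | inj₂ lt′  = ∑-heavy xs lt′

∑-∈ : ∀ {x : X} {xs} f → x ∈ xs → f x ≤ ∑ xs f
∑-∈ f (here refl)         = m≤m+n _ _
∑-∈ f (there {x = y} x∈xs) = m≤n⇒m≤o+n (f y) (∑-∈ f x∈xs)

∑-cong : ∀ (xs : List X) {f g} → (∀ x → f x ≡ g x) → ∑ xs f ≡ ∑ xs g
∑-cong []       f≗g = refl
∑-cong (x ∷ xs) f≗g = cong₂ _+_ (f≗g x) (∑-cong xs f≗g)

∑-+ : ∀ (xs : List X) f g → ∑ xs (λ x → f x + g x) ≡ ∑ xs f + ∑ xs g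
∑-+ []       f g = refl
∑-+ (x ∷ xs) f g = trans (cong (f x + g x +_) (∑-+ xs f g)) (+-interchange (f x) (g x) _ _)

∑-≥ : ∀ (xs : List X) f {b} → (∀ x → b ≤ f x) → length xs * b ≤ ∑ xs f
∑-≥ []       f h = z≤n
∑-≥ (x ∷ xs) f h = +-mono-≤ (h x) (∑-≥ xs f h)

ind : Bool → ℕ
ind b = if b then 1 else 0

ind-∨-∧ : ∀ a b → ind (a ∨ b) + ind (a ∧ b) ≡ ind a + ind b
ind-∨-∧ true  true  = refl
ind-∨-∧ true  false = refl
ind-∨-∧ false true  = refl
ind-∨-∧ false false = refl

-- Coloured binary trees and a Sauer-Shelah count of their subtrees.

module ColouredTree (C : Set) (_≟_ : DecidableEquality C) (palette : List C)
                    (complete : ∀ c → c ∈ palette)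
                    {X : Set} (R : C → X → X → Set) where

  data Tree : ℕ → List X → Set where
    leaf : ∀ x → Tree 0 (x ∷ [])
    node : ∀ {h xs ys} c → Tree h xs → Tree h ys →
           (∀ {x y} → x ∈ xs → y ∈ ys → R c x y) → Tree (suc h) (xs ++ ys)

  -- A word prescribes, for each level of a tree, either to keep one child of every node or to
  -- keep both and require the given colour.
  Word : ℕ → Set
  Word = Vec (Maybe C)

  colours : ∀ {h} → Word h → List C
  colours []            = []
  colours (nothing ∷ w) = colours w
  colours (just c ∷ w)  = c ∷ colours w

  -- Both children of a node are tested on the same tail, so a prescribed colour holds for all
  -- surviving nodes of its level, while the child kept at a `nothing` level may differ from node to
  -- node.
  admissible : ∀ {h xs} → Tree h xs → Word h → Bool
  admissible (leaf _)       []            = true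
  admissible (node c l r _) (nothing ∷ w) = admissible l w ∨ admissible r w
  admissible (node c l r _) (just d ∷ w)  = does (c ≟ d) ∧ admissible l w ∧ admissible r w

  ∑ʷ : ∀ h → (Word h → ℕ) → ℕ
  ∑ʷ zero    f = f []
  ∑ʷ (suc h) f = ∑ʷ h (λ w → f (nothing ∷ w)) + ∑ palette (λ c → ∑ʷ h (λ w → f (just c ∷ w)))

  ∑ʷ-cong : ∀ h {f g} → (∀ w → f w ≡ g w) → ∑ʷ h f ≡ ∑ʷ h g
  ∑ʷ-cong zero    f≗g = f≗g []
  ∑ʷ-cong (suc h) f≗g = cong₂ _+_ (∑ʷ-cong h (λ w → f≗g (nothing ∷ w)))
    (∑-cong palette (λ c → ∑ʷ-cong h (λ w → f≗g (just c ∷ w))))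

  ∑ʷ-+ : ∀ h f g → ∑ʷ h (λ w → f w + g w) ≡ ∑ʷ h f + ∑ʷ h g
  ∑ʷ-+ zero    f g = refl
  ∑ʷ-+ (suc h) f g = trans
    (cong₂ _+_ (∑ʷ-+ h (λ w → f (nothing ∷ w)) (λ w → g (nothing ∷ w)))
      (trans (∑-cong palette (λ c → ∑ʷ-+ h (λ w → f (just c ∷ w)) (λ w → g (just c ∷ w))))
             (∑-+ palette _ _)))
    (+-interchange (∑ʷ h (λ w → f (nothing ∷ w))) _ _ _)

  -- Since ind (a ∨ b) + ind (a ∧ b) = ind a + ind b, the admissible words of a node that start
  -- with nothing or with its own colour are together as many as those of its two children.
  admissible-count : ∀ {h xs} (t : Tree h xs) → 2 ^ h ≤ ∑ʷ h (ind ∘ admissible t)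
  admissible-count (leaf x) = ≤-refl
  admissible-count {suc h} (node c l r sep) = begin
    2 ^ h + (2 ^ h + 0)
      ≡⟨ cong (2 ^ h +_) (+-identityʳ _) ⟩
    2 ^ h + 2 ^ h
      ≤⟨ +-mono-≤ (admissible-count l) (admissible-count r) ⟩
    ∑ʷ h (ind ∘ admissible l) + ∑ʷ h (ind ∘ admissible r)
      ≡⟨ ∑ʷ-+ h _ _ ⟨
    ∑ʷ h (λ w → ind (admissible l w) + ind (admissible r w))
      ≡⟨ ∑ʷ-cong h (λ w → ind-∨-∧ (admissible l w) (admissible r w)) ⟨
    ∑ʷ h (λ w → ind (admissible l w ∨ admissible r w) + ind (admissible l w ∧ admissible r w))
      ≡⟨ ∑ʷ-+ h _ _ ⟩
    ∑ʷ h (λ w → ind (admissible l w ∨ admissible r w)) +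
    ∑ʷ h (λ w → ind (admissible l w ∧ admissible r w))
      ≡⟨ cong (∑ʷ h (λ w → ind (admissible l w ∨ admissible r w)) +_)
           (∑ʷ-cong h (λ w → cong (λ b → ind (b ∧ admissible l w ∧ admissible r w))
             (sym (dec-true (c ≟ c) refl)))) ⟩
    ∑ʷ h (λ w → ind (admissible l w ∨ admissible r w)) +
    ∑ʷ h (λ w → ind (admissible t (just c ∷ w)))
      ≤⟨ +-monoʳ-≤ (∑ʷ h (λ w → ind (admissible l w ∨ admissible r w)))
           (∑-∈ (λ d → ∑ʷ h (λ w → ind (admissible t (just d ∷ w)))) (complete c)) ⟩
    ∑ʷ (suc h) (ind ∘ admissible t) ∎
    where
    open ≤-Reasoning
    t = node c l r sep

  -- The number of words of length h with fewer than J colours.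
  light : ℕ → ℕ → ℕ
  light h       zero    = 0
  light zero    (suc J) = 1
  light (suc h) (suc J) = light h (suc J) + length palette * light h J

  -- The satisfying words are too many to be all light. The induction follows the recurrence of
  -- `light`: the surplus lies on the words that begin with `nothing` or on those that begin with
  -- some colour, and a colour lowers `J` by one.
  ∑ʷ-heavy : ∀ h J (f : Word h → Bool) → light h J < ∑ʷ h (ind ∘ f) →
             ∃ λ w → f w ≡ true × J ≤ length (colours w)
  ∑ʷ-heavy zero zero f lt with f [] in eq
  ... | true = [] , eq , z≤n
  ∑ʷ-heavy zero (suc J) f lt with f []
  ... | true  = contradiction lt (<-irrefl refl)
  ... | false = contradiction lt λ ()
  ∑ʷ-heavy (suc h) zero f lt
    with <-split {0} {length palette * 0}
           (subst (_< ∑ʷ (suc h) (ind ∘ f)) (sym (*-zeroʳ (length palette))) lt)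
  ... | inj₁ lt′ with w , fw , _ ← ∑ʷ-heavy h 0 (λ w → f (nothing ∷ w)) lt′ = nothing ∷ w , fw , z≤n
  ... | inj₂ lt′ with c , lt″ ← ∑-heavy palette lt′
                 with w , fw , _ ← ∑ʷ-heavy h 0 (λ w → f (just c ∷ w)) lt″ = just c ∷ w , fw , z≤n
  ∑ʷ-heavy (suc h) (suc J) f lt with <-split {light h (suc J)} lt
  ... | inj₁ lt′ with w , fw , J< ← ∑ʷ-heavy h (suc J) (λ w → f (nothing ∷ w)) lt′ = nothing ∷ w , fw , J<
  ... | inj₂ lt′ with c , lt″ ← ∑-heavy palette lt′
                 with w , fw , J≤ ← ∑ʷ-heavy h J (λ w → f (just c ∷ w)) lt″ = just c ∷ w , fw , s≤s J≤

  -- With k colours in the palette, give a word with j colours the weight (2k) ^ -j. All words of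
  -- length `h` weigh (3/2) ^ h together, and a word with fewer than `J` colours weighs at least
  -- (2k) ^ -J. The induction clears the denominators.
  light-bound : .{{NonZero (length palette)}} → ∀ h J → light h J * 2 ^ h ≤ 3 ^ h * (2 * length palette) ^ J
  light-bound h       zero    = z≤n
  light-bound zero    (suc J) = ≤-trans (m^n>0 (2 * length palette) (suc J)) (m≤m+n _ 0)
    where instance _ = m*n≢0 2 (length palette)
  light-bound (suc h) (suc J) = begin
    (light h (suc J) + k * light h J) * (2 * 2 ^ h)
      ≡⟨ expand (light h (suc J)) k (light h J) (2 ^ h) ⟩
    2 * (light h (suc J) * 2 ^ h) + 2 * k * (light h J * 2 ^ h)
      ≤⟨ +-mono-≤ (*-monoʳ-≤ 2 (light-bound h (suc J))) (*-monoʳ-≤ (2 * k) (light-bound h J)) ⟩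
    2 * (3 ^ h * (2 * k * (2 * k) ^ J)) + 2 * k * (3 ^ h * (2 * k) ^ J)
      ≡⟨ collect (3 ^ h) (2 * k) ((2 * k) ^ J) ⟩
    3 * 3 ^ h * (2 * k * (2 * k) ^ J) ∎
    where
    open ≤-Reasoning
    k = length palette
    expand : ∀ a k b p → (a + k * b) * (2 * p) ≡ 2 * (a * p) + 2 * k * (b * p)
    expand = solve-∀
    collect : ∀ a k p → 2 * (a * (k * p)) + k * (a * p) ≡ 3 * a * (k * p)
    collect = solve-∀

  -- This fixes the height of the tree. With e = (m + 1) d, `light-bound` yields 27 ^ e * 2 ^ e = 54
  -- ^ e, which stays below 64 ^ e, the square of 2 ^ (3e).
  light-small : ∀ m d .{{_ : NonZero d}} → length palette ≡ 2 ^ m →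
                light (3 * (suc m * d)) d < 2 ^ (3 * (suc m * d))
  light-small m d len = *-cancelʳ-< (2 ^ h) (light h d) (2 ^ h) (begin-strict
    light h d * 2 ^ h                ≤⟨ light-bound {{subst NonZero (sym len) (m^n≢0 2 m)}} h d ⟩
    3 ^ h * (2 * length palette) ^ d ≡⟨ cong (λ k → 3 ^ h * (2 * k) ^ d) len ⟩
    3 ^ h * (2 ^ suc m) ^ d          ≡⟨ cong₂ _*_ (sym (^-*-assoc 3 3 e)) (^-*-assoc 2 (suc m) d) ⟩
    27 ^ e * 2 ^ e                   ≡⟨ ^-distribʳ-* e 27 2 ⟨
    54 ^ e                           <⟨ ^-monoˡ-< e {{m*n≢0 (suc m) d}} (m≤m+n 55 9) ⟩
    64 ^ e                           ≡⟨ ^-distribʳ-* e 8 8 ⟩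
    8 ^ e * 8 ^ e                    ≡⟨ cong₂ _*_ (^-*-assoc 2 3 e) (^-*-assoc 2 3 e) ⟩
    2 ^ h * 2 ^ h                    ∎)
    where
    open ≤-Reasoning
    e = suc m * d
    h = 3 * e

  -- The selected leaves branch only at the levels chosen by `ds`, each of which doubles their
  -- number. Two leaves that part at such a level are related by `R d`, hence by the common
  -- weakening `Q`.
  chain : ∀ {h xs} (t : Tree h xs) w → admissible t w ≡ true →
          ∀ {ds} → ds ⊆ colours w → ∀ {Q : X → X → Set} → All (λ d → ∀ x y → R d x y → Q x y) ds →
          ∃ λ zs → (∀ {x} → x ∈ zs → x ∈ xs) × AllPairs Q zs × length zs ≡ 2 ^ length ds
  chain (leaf x) [] _ [] [] = x ∷ [] , (λ x∈ → x∈) , [] ∷ [] , refl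
  chain (node {xs = xs} c l r sep) (nothing ∷ w) adm ds⊆ all with admissible l w in eq
  ... | true with zs , sub , pairs , len ← chain l w eq ds⊆ all
        = zs , (λ x∈ → ∈-++⁺ˡ (sub x∈)) , pairs , len
  ... | false with zs , sub , pairs , len ← chain r w adm ds⊆ all
        = zs , (λ x∈ → ∈-++⁺ʳ xs (sub x∈)) , pairs , len
  -- At a coloured level outside `ds` both children are admissible, and the left one is kept.
  chain (node c l r sep) (just d ∷ w) adm (_ ∷ʳ ds⊆) all
    with zs , sub , pairs , len ←
           chain l w (∧-conicalˡ _ (admissible r w) (∧-conicalʳ (does (c ≟ d)) _ adm)) ds⊆ all
    = zs , (λ x∈ → ∈-++⁺ˡ (sub x∈)) , pairs , len
  chain (node {xs = xs} {ys} c l r sep) (just d ∷ w) adm (refl ∷ ds⊆) {Q} (RQ ∷ all)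
    with c ≟ d
  ... | yes refl
    with zs , zsub , zpairs , zlen ← chain l w (∧-conicalˡ _ (admissible r w) adm) ds⊆ all
       | us , usub , upairs , ulen ← chain r w (∧-conicalʳ (admissible l w) _ adm) ds⊆ all
    = zs ++ us
    , (λ x∈ → [ ∈-++⁺ˡ ∘ zsub , ∈-++⁺ʳ xs ∘ usub ]′ (∈-++⁻ zs x∈))
    , AllPairsₚ.++⁺ zpairs upairs (All.tabulate (λ x∈ → All.tabulate (λ y∈ → RQ _ _ (sep (zsub x∈) (usub y∈)))))
    , trans (length-++ zs) (cong₂ _+_ zlen (trans ulen (sym (+-identityʳ _))))

-- Falling factorials and a reverse Bernoulli inequality.

falling : ℕ → ℕ → ℕ
falling n       zero    = 1
falling zero    (suc k) = 0
falling (suc n) (suc k) = suc n * falling n k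

-- Pascal's rule, multiplied by the factorial of k + 1.
falling-pascal : ∀ n k → falling (suc n) (suc k) ≡ falling n (suc k) + suc k * falling n k
falling-pascal zero    zero    = refl
falling-pascal zero    (suc k) = sym (*-zeroʳ k)
falling-pascal (suc n) zero    = base n
  where
  base : ∀ n → suc (suc n) * 1 ≡ suc n * 1 + 1 * 1
  base = solve-∀
falling-pascal (suc n) (suc k) = begin
  suc (suc n) * x                                  ≡⟨⟩
  x + suc n * x                                    ≡⟨ cong (λ v → x + suc n * v) (falling-pascal n k) ⟩
  x + suc n * (y + suc k * z)                      ≡⟨ shuffle x (suc n) y (suc k) z ⟩
  suc n * y + (x + suc k * (suc n * z))            ≡⟨⟩
  suc n * y + suc (suc k) * x                      ∎
  where
  open ≡-Reasoning
  x = falling (suc n) (suc k)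
  y = falling n (suc k)
  z = falling n k
  shuffle : ∀ x n y k z → x + n * (y + k * z) ≡ n * y + (x + k * (n * z))
  shuffle = solve-∀

falling≤^ : ∀ n k → falling n k ≤ n ^ k
falling≤^ n       zero    = ≤-refl
falling≤^ zero    (suc k) = z≤n
falling≤^ (suc n) (suc k) = *-monoʳ-≤ (suc n) (≤-trans (falling≤^ n k) (^-monoˡ-≤ k (n≤1+n n)))

^≤falling : ∀ b k {n} → b + k ≤ n → b ^ k ≤ falling n k
^≤falling b zero    _ = ≤-refl
^≤falling b (suc k) {n} le with n | subst (_≤ n) (+-suc b k) le
... | suc n | s≤s le = *-mono-≤ (≤-trans (m≤m+n b k) (m≤n⇒m≤1+n le)) (^≤falling b k le)

-- In fractions this bounds (1 + 1/s) ^ i by 1 + 2i/s. The inductive step produces a quadratic term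
-- 2i/s², which is at most 1/s because 2i ≤ s.
bernoulli : ∀ s i → 2 * i ≤ s → suc s ^ i * s ≤ s ^ i * (s + 2 * i)
bernoulli s zero    _  = ≤-reflexive (cong (_+ 0) (sym (+-identityʳ s)))
bernoulli s (suc i) le = begin
  suc s * suc s ^ i * s            ≡⟨ *-assoc (suc s) (suc s ^ i) s ⟩
  suc s * (suc s ^ i * s)          ≤⟨ *-monoʳ-≤ (suc s) (bernoulli s i 2i≤s) ⟩
  suc s * (s ^ i * (s + 2 * i))    ≡⟨ expand s (s ^ i) i ⟩
  s ^ i * (s * s + s + 2 * (i * s) + 2 * i) ≤⟨ *-monoʳ-≤ (s ^ i) (+-monoʳ-≤ (s * s + s + 2 * (i * s)) 2i≤s) ⟩
  s ^ i * (s * s + s + 2 * (i * s) + s)     ≡⟨ collect s (s ^ i) i ⟩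
  s * s ^ i * (s + 2 * suc i)      ∎
  where
  open ≤-Reasoning
  2i≤s = ≤-trans (*-monoʳ-≤ 2 (n≤1+n i)) le
  expand : ∀ s p i → suc s * (p * (s + 2 * i)) ≡ p * (s * s + s + 2 * (i * s) + 2 * i)
  expand = solve-∀
  collect : ∀ s p i → p * (s * s + s + 2 * (i * s) + s) ≡ s * p * (s + 2 * suc i)
  collect = solve-∀

[1+2k]^k≤2[2k]^k : ∀ k .{{_ : NonZero k}} → suc (2 * k) ^ k ≤ 2 * (2 * k) ^ k
[1+2k]^k≤2[2k]^k k = *-cancelʳ-≤ _ _ s (≤-trans (bernoulli s k ≤-refl) (≤-reflexive (twice (s ^ k) s)))
  where
  s = 2 * k
  instance _ = m*n≢0 2 k
  twice : ∀ p s → p * (s + s) ≡ 2 * p * s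
  twice = solve-∀

-- Levels at which many rows have constant sign.

count : (X → Bool) → List X → ℕ
count p xs = ∑ xs (ind ∘ p)

count-not : ∀ (p : X → Bool) xs → count p xs + count (not ∘ p) xs ≡ length xs
count-not p []       = refl
count-not p (x ∷ xs) with p x
... | true  = cong suc (count-not p xs)
... | false = trans (+-suc _ _) (cong suc (count-not p xs))

module _ (good : C → X → Bool) where

  -- An element good for `c` has its count raised by one, so `falling-pascal` splits its term; any
  -- other element contributes the same term to both sides.
  ∑-falling-∷ : ∀ c cs ℓ S →
    ∑ S (λ k → falling (count (λ c → good c k) (c ∷ cs)) (suc ℓ)) ≡
    ∑ S (λ k → falling (count (λ c → good c k) cs) (suc ℓ)) +
    suc ℓ * ∑ (filter (T? ∘ good c) S) (λ k → falling (count (λ c → good c k) cs) ℓ)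
  ∑-falling-∷ c cs ℓ [] = sym (*-zeroʳ ℓ)
  ∑-falling-∷ c cs ℓ (k ∷ S) with good c k
  ... | true  = trans (cong₂ _+_ (falling-pascal n ℓ) (∑-falling-∷ c cs ℓ S))
                      (shuffle (falling n (suc ℓ)) (suc ℓ) (falling n ℓ) _ _)
    where
    n = count (λ c → good c k) cs
    shuffle : ∀ x l y a b → x + l * y + (a + l * b) ≡ x + a + l * (y + b)
    shuffle = solve-∀
  ... | false = trans (cong (falling n (suc ℓ) +_) (∑-falling-∷ c cs ℓ S)) (sym (+-assoc (falling n (suc ℓ)) _ _))
    where n = count (λ c → good c k) cs

  -- Both sides satisfy the Pascal recurrence, so this is an average over
  -- the ℓ-element sublists of cs.
  select : ∀ cs ℓ B S →
    falling (length cs) ℓ * B < ∑ S (λ k → falling (count (λ c → good c k) cs) ℓ) →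
    ∃₂ λ ds S′ → ds ⊆ cs × length ds ≡ ℓ × S′ ⊆ S × B < length S′ ×
      All (λ d → All (T ∘ good d) S′) ds
  select cs zero B S lt
    = [] , S , minimum cs , refl , ⊆-refl
    , <-≤-trans (subst (_< _) (+-identityʳ B) lt) (≤-reflexive (ones S)) , []
    where
    ones : ∀ (S : List X) → ∑ S (λ _ → 1) ≡ length S
    ones []      = refl
    ones (_ ∷ S) = cong suc (ones S)
  select [] (suc ℓ) B S lt = contradiction lt (≤⇒≯ (≤-reflexive (zeros S)))
    where
    zeros : ∀ (S : List X) → ∑ S (λ _ → 0) ≡ 0
    zeros []      = refl
    zeros (_ ∷ S) = zeros S
  select (c ∷ cs) (suc ℓ) B S lt
    with <-split {falling (length cs) (suc ℓ) * B} {suc ℓ * (falling (length cs) ℓ * B)} (subst₂ _<_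
           (trans (cong (_* B) (falling-pascal (length cs) ℓ))
             (trans (*-distribʳ-+ B (falling (length cs) (suc ℓ)) _)
               (cong (falling (length cs) (suc ℓ) * B +_) (*-assoc (suc ℓ) (falling (length cs) ℓ) B))))
           (∑-falling-∷ c cs ℓ S) lt)
  ... | inj₁ lt′ with ds , S′ , ds⊆ , len , rest ← select cs (suc ℓ) B S lt′
        = ds , S′ , c ∷ʳ ds⊆ , len , rest
  ... | inj₂ lt′ with ds , S′ , ds⊆ , len , S′⊆ , B< , all ←
                        select cs ℓ B (filter (T? ∘ good c) S) (*-cancelˡ-< (suc ℓ) _ _ lt′)
        = c ∷ ds , S′ , refl ∷ ds⊆ , cong suc len , ⊆-trans S′⊆ (filter-⊆ (T? ∘ good c) S) , B<
        , All-resp-⊆ S′⊆ (all-filter (T? ∘ good c) S) ∷ all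

-- A row whose signs agree on b + ℓ of the 2 (b + ℓ) levels, b = 2ℓ², has constant sign on a random
-- choice of ℓ levels with probability at least 2 ^ -ℓ / 2.
select-constant : ∀ (sign : C → X → Bool) ℓ .{{_ : NonZero ℓ}} cs S →
  length cs ≡ 2 * (suc (2 * ℓ) * ℓ) → length S ≡ 4 * (2 ^ ℓ * 2 ^ ℓ) →
  ∃ λ b → ∃₂ λ ds S′ → ds ⊆ cs × length ds ≡ ℓ × S′ ⊆ S × 2 ^ ℓ ≤ length S′ ×
    All (λ d → All (λ k → sign d k ≡ b) S′) ds
select-constant {C} {X} sign ℓ cs S lenC lenS = answer
  where
  q = 2 ^ ℓ
  s = 2 * ℓ
  b = s * ℓ
  a = suc s * ℓ
  pos neg : X → ℕ
  pos k = falling (count (λ c → sign c k) cs) ℓ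
  neg k = falling (count (λ c → not (sign c k)) cs) ℓ

  a≡b+ℓ : a ≡ b + ℓ
  a≡b+ℓ = +-comm ℓ b

  -- Of the `2 * a` signs of `k`, one value occurs at least `a`, that is `b + ℓ`, times.
  many : ∀ k → b ^ ℓ ≤ pos k + neg k
  many k with ≤-total a p
    where p = count (λ c → sign c k) cs
  ... | inj₁ a≤p = m≤n⇒m≤n+o (neg k) (^≤falling b ℓ (≤-trans (≤-reflexive (sym a≡b+ℓ)) a≤p))
  ... | inj₂ p≤a = m≤n⇒m≤o+n (pos k) (^≤falling b ℓ (+-cancelˡ-≤ a (b + ℓ) n (begin
    a + (b + ℓ)    ≡⟨ cong (a +_) (trans (sym a≡b+ℓ) (sym (+-identityʳ a))) ⟩
    2 * a          ≡⟨ lenC ⟨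
    length cs      ≡⟨ count-not (λ c → sign c k) cs ⟨
    p + n          ≤⟨ +-monoˡ-≤ n p≤a ⟩
    a + n          ∎)))
    where
    open ≤-Reasoning
    p = count (λ c → sign c k) cs
    n = count (λ c → not (sign c k)) cs

  -- The ratio of `length cs` to `b` is 2 (1 + 1/s). For s = 2ℓ the power (1 + 1/s) ^ ℓ is at most
  -- 2, which leaves the factor `2 * q`.
  total : falling (length cs) ℓ ≤ 2 * q * b ^ ℓ
  total = begin
    falling (length cs) ℓ      ≤⟨ falling≤^ (length cs) ℓ ⟩
    length cs ^ ℓ              ≡⟨ cong (_^ ℓ) lenC ⟩
    (2 * (suc s * ℓ)) ^ ℓ      ≡⟨ ^-distribʳ-* ℓ 2 (suc s * ℓ) ⟩
    q * (suc s * ℓ) ^ ℓ        ≡⟨ cong (q *_) (^-distribʳ-* ℓ (suc s) ℓ) ⟩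
    q * (suc s ^ ℓ * ℓ ^ ℓ)    ≤⟨ *-monoʳ-≤ q (*-monoˡ-≤ (ℓ ^ ℓ) ([1+2k]^k≤2[2k]^k ℓ)) ⟩
    q * (2 * s ^ ℓ * ℓ ^ ℓ)    ≡⟨ shuffle q (s ^ ℓ) (ℓ ^ ℓ) ⟩
    2 * q * (s ^ ℓ * ℓ ^ ℓ)    ≡⟨ cong (2 * q *_) (^-distribʳ-* ℓ s ℓ) ⟨
    2 * q * b ^ ℓ              ∎
    where
    open ≤-Reasoning
    shuffle : ∀ q x y → q * (2 * x * y) ≡ 2 * q * (x * y)
    shuffle = solve-∀

  instance
    q≢0 : NonZero q
    q≢0 = m^n≢0 2 ℓ
    b^ℓ≢0 : NonZero (b ^ ℓ)
    b^ℓ≢0 = m^n≢0 b ℓ {{m*n≢0 s ℓ {{m*n≢0 2 ℓ}}}}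

  -- `select` yields strictly more than the given number of rows, so `pred q` suffices for `q` of
  -- them; it also makes `large` strict.
  F = falling (length cs) ℓ * pred q

  large : F + F < ∑ S pos + ∑ S neg
  large = begin-strict
    F + F                       ≤⟨ +-mono-≤ F≤ F≤ ⟩
    2 * q * b ^ ℓ * pred q + 2 * q * b ^ ℓ * pred q   ≡⟨ collect q (b ^ ℓ) (pred q) ⟩
    4 * q * b ^ ℓ * pred q      <⟨ *-monoʳ-< (4 * q * b ^ ℓ) {{m*n≢0 (4 * q) (b ^ ℓ) {{m*n≢0 4 q}}}} (≤-reflexive (suc-pred q)) ⟩
    4 * q * b ^ ℓ * q           ≡⟨ reorder q (b ^ ℓ) ⟩
    4 * (q * q) * b ^ ℓ         ≡⟨ cong (_* b ^ ℓ) lenS ⟨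
    length S * b ^ ℓ            ≤⟨ ∑-≥ S (λ k → pos k + neg k) many ⟩
    ∑ S (λ k → pos k + neg k)   ≡⟨ ∑-+ S pos neg ⟩
    ∑ S pos + ∑ S neg           ∎
    where
    open ≤-Reasoning
    F≤ = *-monoˡ-≤ (pred q) total
    collect : ∀ q x p → 2 * q * x * p + 2 * q * x * p ≡ 4 * q * x * p
    collect = solve-∀
    reorder : ∀ q x → 4 * q * x * q ≡ 4 * (q * q) * x
    reorder = solve-∀

  T⇒≡ : ∀ {x} → T x → x ≡ true
  T⇒≡ {true} _ = refl
  T-not⇒≡ : ∀ {x} → T (not x) → x ≡ false
  T-not⇒≡ {false} _ = refl

  answer : ∃ λ b → ∃₂ λ ds S′ → ds ⊆ cs × length ds ≡ ℓ × S′ ⊆ S × q ≤ length S′ ×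
    All (λ d → All (λ k → sign d k ≡ b) S′) ds
  answer with <-split {F} {F} large
  ... | inj₁ lt with ds , S′ , ds⊆ , len , S′⊆ , B< , all ← select sign cs ℓ (pred q) S lt
    = true , ds , S′ , ds⊆ , len , S′⊆ , subst (_≤ length S′) (suc-pred q) B< , All.map (All.map T⇒≡) all
  ... | inj₂ lt with ds , S′ , ds⊆ , len , S′⊆ , B< , all ← select (λ c k → not (sign c k)) cs ℓ (pred q) S lt
    = false , ds , S′ , ds⊆ , len , S′⊆ , subst (_≤ length S′) (suc-pred q) B< , All.map (All.map T-not⇒≡) all

-- Sorting lists and cutting them in two.

AllPairs-++⁻ : ∀ {R : X → X → Set} xs {ys} → AllPairs R (xs ++ ys) →
               ∀ {x y} → x ∈ xs → y ∈ ys → R x y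
AllPairs-++⁻ (_ ∷ xs) (Rx ∷ _)  (here refl) y∈ = All.lookup Rx (∈-++⁺ʳ xs y∈)
AllPairs-++⁻ (_ ∷ xs) (_ ∷ Rxs) (there x∈) y∈ = AllPairs-++⁻ xs Rxs x∈ y∈

module _ {_≲_ : X → X → Set} (≲-total : Total _≲_) (≲-trans : Transitive _≲_) where

  sorted-insert : ∀ x {xs} → AllPairs _≲_ xs → ∃ λ ys → ys ↭ x ∷ xs × AllPairs _≲_ ys
  sorted-insert x [] = x ∷ [] , ↭-refl , [] ∷ []
  sorted-insert x {y ∷ xs} (y≲xs ∷ sorted) with ≲-total x y
  ... | inj₁ x≲y = x ∷ y ∷ xs , ↭-refl , (x≲y ∷ All.map (≲-trans x≲y) y≲xs) ∷ y≲xs ∷ sorted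
  ... | inj₂ y≲x with ys , ys↭ , sorted′ ← sorted-insert x sorted
    = y ∷ ys , ↭-trans (prep y ys↭) (swap y x ↭-refl)
    , All-resp-↭ (↭-sym ys↭) (y≲x ∷ y≲xs) ∷ sorted′

  sort : ∀ xs → ∃ λ ys → ys ↭ xs × AllPairs _≲_ ys
  sort [] = [] , ↭-refl , []
  sort (x ∷ xs) with ys , ys↭ , sorted ← sort xs with zs , zs↭ , sorted′ ← sorted-insert x sorted
    = zs , ↭-trans zs↭ (prep x ys↭) , sorted′

  -- A sorted copy is cut after `a` elements. The order within `rs` is returned so that `bisect` can
  -- use its head, and `x ≢ y` so that `tree` can make the order of columns strict.
  halve : ∀ a b {xs} → Unique xs → length xs ≡ a + b →
          ∃₂ λ ls rs → Unique ls × Unique rs × length ls ≡ a × length rs ≡ b ×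
            (∀ {x} → x ∈ ls → x ∈ xs) × (∀ {x} → x ∈ rs → x ∈ xs) ×
            (∀ {x y} → x ∈ ls → y ∈ rs → x ≲ y × x ≢ y) × AllPairs _≲_ rs
  halve a b {xs} xs! len with ys , ys↭ , sorted ← sort xs =
    ls , rs , AllPairsₚ.take⁺ a ys! , AllPairsₚ.drop⁺ a ys!
    , trans (length-take a ys) (trans (cong (a ⊓_) lenys) (m≤n⇒m⊓n≡m (m≤m+n a b)))
    , trans (length-drop a ys) (trans (cong (_∸ a) lenys) (m+n∸m≡n a b))
    , (λ x∈ → ∈-resp-↭ ys↭ (subst (_ ∈_) ls++rs (∈-++⁺ˡ x∈)))
    , (λ x∈ → ∈-resp-↭ ys↭ (subst (_ ∈_) ls++rs (∈-++⁺ʳ ls x∈)))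
    , AllPairs-++⁻ ls (subst (AllPairs _) (sym ls++rs) (AllPairs.zip (sorted , ys!)))
    , AllPairsₚ.drop⁺ a sorted
    where
    ls = take a ys
    rs = drop a ys
    ls++rs : ls ++ rs ≡ ys
    ls++rs = take++drop≡id a ys
    lenys = trans (↭-length ys↭) len
    ys! : Unique ys
    ys! = Permₛ.Unique-resp-↭ (setoid X) (↭⇒↭ₛ (↭-sym ys↭)) xs!

  -- The pivot `p` is the first element of the sorted upper part, which exists since `b` is nonzero.
  -- Comparing the pivots of two lists then orders whole parts of them.
  bisect : ∀ a b .{{_ : NonZero b}} {xs} → Unique xs → length xs ≡ a + b →
           ∃ λ p → ∃₂ λ ls rs → Unique ls × Unique rs × length ls ≡ a × length rs ≡ b ×
             (∀ {x} → x ∈ ls → x ∈ xs × x ≲ p) × (∀ {x} → x ∈ rs → x ∈ xs × p ≲ x)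
  bisect a b@(suc _) xs! len with halve a b xs! len
  ... | ls , p ∷ rs , ls! , rs! , lenls , lenrs , ls⊆ , rs⊆ , ls≲rs , p≲rs ∷ _
    = p , ls , p ∷ rs , ls! , rs! , lenls , lenrs
    , (λ x∈ → ls⊆ x∈ , proj₁ (ls≲rs x∈ (here refl)))
    , (λ x∈ → rs⊆ x∈ , p≲ x∈)
    where
    p≲ : ∀ {x} → x ∈ p ∷ rs → p ≲ x
    p≲ (here refl) = [ (λ r → r) , (λ r → r) ]′ (≲-total p p)
    p≲ (there x∈)  = All.lookup p≲rs x∈

-- The palette of sign vectors.

boolVecs : ∀ m → List (Vec Bool m)
boolVecs zero    = [] ∷ []
boolVecs (suc m) = map (true ∷_) (boolVecs m) ++ map (false ∷_) (boolVecs m)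

∈-boolVecs : ∀ {m} (v : Vec Bool m) → v ∈ boolVecs m
∈-boolVecs []          = here refl
∈-boolVecs (true  ∷ v) = ∈-++⁺ˡ (∈-map⁺ (true ∷_) (∈-boolVecs v))
∈-boolVecs (false ∷ v) = ∈-++⁺ʳ _ (∈-map⁺ (false ∷_) (∈-boolVecs v))

length-boolVecs : ∀ m → length (boolVecs m) ≡ 2 ^ m
length-boolVecs zero    = refl
length-boolVecs (suc m) = trans (length-++ (map (true ∷_) (boolVecs m)))
  (cong₂ _+_ (trans (length-map _ (boolVecs m)) (length-boolVecs m))
             (trans (trans (length-map _ (boolVecs m)) (length-boolVecs m)) (sym (+-identityʳ _))))

-- Sublists and indexed access to their elements.

AllPairs-resp-⊆ : ∀ {R : X → X → Set} {xs ys} → xs ⊆ ys → AllPairs R ys → AllPairs R xs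
AllPairs-resp-⊆ []          []         = []
AllPairs-resp-⊆ (_ ∷ʳ xs⊆)  (_ ∷ Rys)  = AllPairs-resp-⊆ xs⊆ Rys
AllPairs-resp-⊆ (refl ∷ xs⊆) (Ry ∷ Rys) = All-resp-⊆ xs⊆ Ry ∷ AllPairs-resp-⊆ xs⊆ Rys

AllPairs-lookup : ∀ {R : X → X → Set} {xs} → AllPairs R xs →
                  ∀ {i j} → i <ᶠ j → R (List.lookup xs i) (List.lookup xs j)
AllPairs-lookup {xs = _ ∷ xs} (Rx ∷ _) {zero} {suc j} _ = All.lookup Rx (∈-lookup j)
AllPairs-lookup (_ ∷ Rxs) {suc i} {suc j} (s≤s i<j) = AllPairs-lookup Rxs i<j

inject≤-mono-< : ∀ {m n} (m≤n : m ≤ n) {i j : Fin m} → i <ᶠ j → inject≤ i m≤n <ᶠ inject≤ j m≤n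
inject≤-mono-< m≤n {i} {j} = subst₂ _<_ (sym (Fin.toℕ-inject≤ i m≤n)) (sym (Fin.toℕ-inject≤ j m≤n))

pick : ∀ {n} (xs : List X) → n ≤ length xs → Fin n → X
pick xs n≤ i = List.lookup xs (inject≤ i n≤)

AllPairs-pick : ∀ {R : X → X → Set} {xs n} (n≤ : n ≤ length xs) → AllPairs R xs →
                ∀ {i j} → i <ᶠ j → R (pick xs n≤ i) (pick xs n≤ j)
AllPairs-pick n≤ Rxs i<j = AllPairs-lookup Rxs (inject≤-mono-< n≤ i<j)

allFin-sorted : ∀ n → AllPairs _<ᶠ_ (allFin n)
allFin-sorted n = AllPairsₚ.tabulate⁺-< (λ i<j → i<j)

-- Pigeonhole and Ramsey arguments on lists.

dichotomy : ∀ {P Q : X → Set} {xs} → All (λ x → P x ⊎ Q x) xs →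
            ∃₂ λ ys zs → ys ⊆ xs × zs ⊆ xs × All P ys × All Q zs × length ys + length zs ≡ length xs
dichotomy [] = [] , [] , [] , [] , [] , [] , refl
dichotomy {xs = x ∷ _} (PQ ∷ PQs) with dichotomy PQs | PQ
... | ys , zs , ys⊆ , zs⊆ , Pys , Qzs , len | inj₁ Px
  = x ∷ ys , zs , refl ∷ ys⊆ , x ∷ʳ zs⊆ , Px ∷ Pys , Qzs , cong suc len
... | ys , zs , ys⊆ , zs⊆ , Pys , Qzs , len | inj₂ Qx
  = ys , x ∷ zs , x ∷ʳ ys⊆ , refl ∷ zs⊆ , Pys , Qx ∷ Qzs , trans (+-suc _ _) (cong suc len)

pigeonhole : ∀ K {P : Fin K → X → Set} s {xs} → All (λ x → ∃ λ k → P k x) xs →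
             K * s < length xs → ∃₂ λ k ys → ys ⊆ xs × s < length ys × All (P k) ys
pigeonhole zero s ((() , _) ∷ _) lt
pigeonhole (suc K) {P} s {xs} all lt
  with ys , zs , ys⊆ , zs⊆ , Pys , Pzs , len ←
         dichotomy (All.map (λ { (zero , p) → inj₁ p ; (suc k , p) → inj₂ (k , p) }) all)
  with <-split {s} (subst (s + K * s <_) (sym len) lt)
... | inj₁ s< = zero , ys , ys⊆ , s< , Pys
... | inj₂ Ks< with k , us , us⊆ , s< , Pus ← pigeonhole K {P ∘ suc} s Pzs Ks<
  = suc k , us , ⊆-trans us⊆ zs⊆ , s< , Pus

-- The elements after the head are divided by their relation to it, and the head extends a chain
-- found in the matching part. The Erdős-Szekeres bound is far smaller, but here `a` and `b` become
-- m and the cost in the final exponent is 2m², still of order n ^ 4.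
ramsey : ∀ {P Q : X → X → Set} → (∀ x y → P x y ⊎ Q x y) → ∀ a b xs → 2 ^ (a + b) ≤ length xs →
         (∃ λ ys → ys ⊆ xs × a ≤ length ys × AllPairs P ys) ⊎
         (∃ λ ys → ys ⊆ xs × b ≤ length ys × AllPairs Q ys)
ramsey pq zero    b       xs le = inj₁ ([] , minimum xs , z≤n , [])
ramsey pq (suc a) zero    xs le = inj₂ ([] , minimum xs , z≤n , [])
ramsey pq (suc a) (suc b) [] le = contradiction le (<⇒≱ (m^n>0 2 (suc a + suc b)))
ramsey pq (suc a) (suc b) (x ∷ xs) le
  with ys , zs , ys⊆ , zs⊆ , Pys , Qzs , len ← dichotomy (All.universal (pq x) xs)
  with <-≤-connex (length ys) (2 ^ (a + suc b))
... | inj₂ k≤ with ramsey pq a (suc b) ys k≤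
...   | inj₁ (us , us⊆ , a≤ , pairs) =
        inj₁ (x ∷ us , refl ∷ ⊆-trans us⊆ ys⊆ , s≤s a≤ , All-resp-⊆ us⊆ Pys ∷ pairs)
...   | inj₂ (us , us⊆ , b≤ , pairs) = inj₂ (us , x ∷ʳ ⊆-trans us⊆ ys⊆ , b≤ , pairs)
ramsey pq (suc a) (suc b) (x ∷ xs) le
    | inj₁ <k with ramsey pq (suc a) b zs (subst (λ e → 2 ^ e ≤ length zs) (+-suc a b) k≤)
    where
    k = 2 ^ (a + suc b)
    -- The list has at least 2k elements, and the head together with `ys` accounts for at most k of
    -- them.
    k≤ : k ≤ length zs
    k≤ = +-cancelˡ-≤ k _ _ (begin
      k + k                            ≡⟨ cong (k +_) (+-identityʳ k) ⟨
      2 * k                            ≤⟨ le ⟩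
      suc (length xs)                  ≡⟨ cong suc len ⟨
      suc (length ys) + length zs      ≤⟨ +-monoˡ-≤ (length zs) <k ⟩
      k + length zs                    ∎)
      where open ≤-Reasoning
...   | inj₁ (us , us⊆ , a≤ , pairs) = inj₁ (us , x ∷ʳ ⊆-trans us⊆ zs⊆ , a≤ , pairs)
...   | inj₂ (us , us⊆ , b≤ , pairs) =
        inj₂ (x ∷ us , refl ∷ ⊆-trans us⊆ zs⊆ , s≤s b≤ , All-resp-⊆ us⊆ Qzs ∷ pairs)

-- Parameters and their size.

-- The terms of `exponent` are binary logarithms: the second counts the maps from m indices into the
-- first 2 ^ (m + m) rows, the third the columns that the tree consumes. Of the initial 2, one unit
-- pays for the two directions of a column and one for a strict inequality.
rows levels exponent : ℕ → ℕ
rows ℓ     = 4 * (2 ^ ℓ * 2 ^ ℓ)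
levels ℓ   = 2 * (suc (2 * ℓ) * ℓ)
exponent ℓ = 2 + (m + m) * m + suc m * (3 * (suc m * levels ℓ))
  where m = rows ℓ

n≤2^⌈log₂n⌉ : ∀ n → n ≤ 2 ^ ⌈log₂ n ⌉
n≤2^⌈log₂n⌉ = <-rec _ step
  where
  open ≤-Reasoning
  step : ∀ n → (∀ {k} → k < n → k ≤ 2 ^ ⌈log₂ k ⌉) → n ≤ 2 ^ ⌈log₂ n ⌉
  step zero          _   = z≤n
  step (suc zero)    _   = ≤-refl
  step n@(suc (suc n-2)) rec = begin
    n                                ≡⟨ ⌊n/2⌋+⌈n/2⌉≡n n ⟨
    ⌊ n /2⌋ + ⌈ n /2⌉                ≤⟨ +-monoˡ-≤ ⌈ n /2⌉ (⌊n/2⌋≤⌈n/2⌉ n) ⟩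
    ⌈ n /2⌉ + ⌈ n /2⌉                ≡⟨ cong (⌈ n /2⌉ +_) (+-identityʳ _) ⟨
    2 * ⌈ n /2⌉                      ≤⟨ *-monoʳ-≤ 2 (rec (⌈n/2⌉<n n-2)) ⟩
    2 * 2 ^ ⌈log₂ ⌈ n /2⌉ ⌉          ≡⟨ cong (λ k → 2 ^ suc k) (⌈log₂⌈n/2⌉⌉≡⌈log₂n⌉∸1 n) ⟩
    2 ^ suc (⌈log₂ n ⌉ ∸ 1)          ≡⟨ cong (2 ^_) (m+[n∸m]≡n {1} (⌈log₂⌉-mono-≤ {2} {n} (s≤s (s≤s z≤n)))) ⟩
    2 ^ ⌈log₂ n ⌉                    ∎

2^⌈log₂n⌉≤2n : ∀ n .{{_ : NonZero n}} → 2 ^ ⌈log₂ n ⌉ ≤ 2 * n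
2^⌈log₂n⌉≤2n n with ⌈log₂ n ⌉ in eq
... | zero  = ≤-trans (>-nonZero⁻¹ n) (m≤n*m n 2)
... | suc ℓ = *-monoʳ-≤ 2 (≮⇒≥ {n} {2 ^ ℓ} λ n<2^ℓ → <-irrefl refl (begin-strict
  ℓ            <⟨ ≤-refl ⟩
  suc ℓ        ≡⟨ eq ⟨
  ⌈log₂ n ⌉    ≤⟨ ⌈log₂⌉-mono-≤ {n} {2 ^ ℓ} (<⇒≤ n<2^ℓ) ⟩
  ⌈log₂ 2 ^ ℓ ⌉ ≡⟨ ⌈log₂2^n⌉≡n ℓ ⟩
  ℓ            ∎))
  where open ≤-Reasoning

-- With x = n² and y = ℓ², m ≤ 16x, m + 1 ≤ 17x and `levels ℓ` ≤ 6y, so the constant is 2 + 32 * 16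
-- + 17 * 3 * 17 * 6. Since y ≥ 1, the middle term may take on the factor y.
exponent-bound : ∀ n ℓ → 1 ≤ n → 1 ≤ ℓ → 2 ^ ℓ ≤ 2 * n → exponent ℓ ≤ 5716 * n ^ 4 * ℓ ^ 2
exponent-bound n ℓ 1≤n 1≤ℓ q≤ = begin
  2 + (m + m) * m + suc m * (3 * (suc m * levels ℓ))
    ≤⟨ +-mono-≤ (+-mono-≤ (*-monoʳ-≤ 2 (*-mono-≤ 1≤x (*-mono-≤ 1≤x 1≤y))) (*-mono-≤ (+-mono-≤ m≤ m≤) m≤))
         (*-mono-≤ sm≤ (*-monoʳ-≤ 3 (*-mono-≤ sm≤ d≤))) ⟩
  2 * (x * (x * y)) + (16 * x + 16 * x) * (16 * x) + 17 * x * (3 * (17 * x * (6 * y)))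
    ≤⟨ +-monoˡ-≤ _ (+-monoʳ-≤ (2 * (x * (x * y)))
         (m≤m*n ((16 * x + 16 * x) * (16 * x)) y {{>-nonZero 1≤y}})) ⟩
  2 * (x * (x * y)) + (16 * x + 16 * x) * (16 * x) * y + 17 * x * (3 * (17 * x * (6 * y)))
    ≡⟨ collect n ℓ ⟩
  5716 * n ^ 4 * ℓ ^ 2 ∎
  where
  open ≤-Reasoning
  m = rows ℓ
  x = n * n
  y = ℓ * ℓ
  1≤x : 1 ≤ x
  1≤x = *-mono-≤ 1≤n 1≤n
  1≤y : 1 ≤ y
  1≤y = *-mono-≤ 1≤ℓ 1≤ℓ
  m≤ : m ≤ 16 * x
  m≤ = ≤-trans (*-monoʳ-≤ 4 (*-mono-≤ q≤ q≤)) (≤-reflexive (square n))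
    where
    square : ∀ n → 4 * (2 * n * (2 * n)) ≡ 16 * (n * n)
    square = solve-∀
  sm≤ : suc m ≤ 17 * x
  sm≤ = +-mono-≤ 1≤x m≤
  d≤ : levels ℓ ≤ 6 * y
  d≤ = begin
    2 * (suc (2 * ℓ) * ℓ)    ≤⟨ *-monoʳ-≤ 2 (*-monoˡ-≤ ℓ (+-monoˡ-≤ (2 * ℓ) 1≤ℓ)) ⟩
    2 * ((ℓ + 2 * ℓ) * ℓ)    ≡⟨ triple ℓ ⟩
    6 * (ℓ * ℓ)              ∎
    where
    triple : ∀ ℓ → 2 * ((ℓ + 2 * ℓ) * ℓ) ≡ 6 * (ℓ * ℓ)
    triple = solve-∀
  collect : ∀ n ℓ → let x = n * n ; y = ℓ * ℓ in
    2 * (x * (x * y)) + (16 * x + 16 * x) * (16 * x) * y + 17 * x * (3 * (17 * x * (6 * y))) ≡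
    5716 * (n * (n * (n * (n * 1)))) * (ℓ * (ℓ * 1))
  collect = solve-∀

-- The tree of columns over a total order.

module TotallyOrdered (O : TotalOrder 0ℓ 0ℓ 0ℓ) where
  open TotalOrder O using ()
    renaming (Carrier to A; _≤_ to _⊑_; total to ⊑-total; trans to ⊑-trans; refl to ⊑-refl)

  Directed : Bool → A → A → Set
  Directed true  x y = x ⊑ y
  Directed false x y = y ⊑ x

  -- Comparing the medians in row 0 decides which two opposite halves survive.
  separate : ∀ m (f : Fin m → X → A) s .{{_ : NonZero s}} {xs ys} → Unique xs → Unique ys →
    length xs ≡ 2 ^ m * s → length ys ≡ 2 ^ m * s →
    ∃ λ (c : Vec Bool m) → ∃₂ λ xs′ ys′ →
      Unique xs′ × Unique ys′ × length xs′ ≡ s × length ys′ ≡ s ×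
      (∀ {x} → x ∈ xs′ → x ∈ xs) × (∀ {y} → y ∈ ys′ → y ∈ ys) ×
      (∀ {x y} → x ∈ xs′ → y ∈ ys′ → ∀ i → Directed (lookup c i) (f i x) (f i y))
  separate zero f s xs! ys! lenx leny =
    [] , _ , _ , xs! , ys! , trans lenx (+-identityʳ s) , trans leny (+-identityʳ s) ,
    (λ x∈ → x∈) , (λ y∈ → y∈) , λ _ _ ()
  separate (suc m) f s {xs} {ys} xs! ys! lenx leny
    with bisect f₀-total ⊑-trans t t xs! (trans lenx double)
       | bisect f₀-total ⊑-trans t t ys! (trans leny double)
    where
    t = 2 ^ m * s
    instance _ = m*n≢0 (2 ^ m) s {{m^n≢0 2 m}}
    f₀-total : Total (λ x y → f zero x ⊑ f zero y)
    f₀-total x y = ⊑-total (f zero x) (f zero y)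
    double : 2 ^ suc m * s ≡ t + t
    double = trans (*-assoc 2 (2 ^ m) s) (cong (t +_) (+-identityʳ t))
  ... | p , xl , xr , xl! , xr! , lenxl , lenxr , xl⊑p , p⊑xr
      | q , yl , yr , yl! , yr! , lenyl , lenyr , yl⊑q , q⊑yr
    with ⊑-total (f zero p) (f zero q)
  ... | inj₁ p⊑q with c , xs′ , ys′ , xs′! , ys′! , lenx′ , leny′ , xs′⊆ , ys′⊆ , sep ←
                        separate m (f ∘ suc) s xl! yr! lenxl lenyr
    = true ∷ c , xs′ , ys′ , xs′! , ys′! , lenx′ , leny′
    , proj₁ ∘ xl⊑p ∘ xs′⊆ , proj₁ ∘ q⊑yr ∘ ys′⊆
    , λ { x∈ y∈ zero → ⊑-trans (proj₂ (xl⊑p (xs′⊆ x∈))) (⊑-trans p⊑q (proj₂ (q⊑yr (ys′⊆ y∈))))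
        ; x∈ y∈ (suc i) → sep x∈ y∈ i }
  ... | inj₂ q⊑p with c , xs′ , ys′ , xs′! , ys′! , lenx′ , leny′ , xs′⊆ , ys′⊆ , sep ←
                        separate m (f ∘ suc) s xr! yl! lenxr lenyl
    = false ∷ c , xs′ , ys′ , xs′! , ys′! , lenx′ , leny′
    , proj₁ ∘ p⊑xr ∘ xs′⊆ , proj₁ ∘ yl⊑q ∘ ys′⊆
    , λ { x∈ y∈ zero → ⊑-trans (proj₂ (yl⊑q (ys′⊆ y∈))) (⊑-trans q⊑p (proj₂ (p⊑xr (xs′⊆ x∈))))
        ; x∈ y∈ (suc i) → sep x∈ y∈ i }

  module _ {N m : ℕ} (f : Fin m → Fin N → A) where

    -- The condition `x <ᶠ y` keeps the leaves of a tree in the order of the columns.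
    Compared : Vec Bool m → Fin N → Fin N → Set
    Compared c x y = x <ᶠ y × (∀ i → Directed (lookup c i) (f i x) (f i y))

    open ColouredTree (Vec Bool m) (≡-dec _≟ᵇ_) (boolVecs m) ∈-boolVecs Compared public

    -- Each level costs a factor 2 ^ (m + 1): halving by column index takes one factor 2, and
    -- `separate` takes 2 ^ m from each half. The sign vector it returns colours the root.
    tree : ∀ h {xs} → Unique xs → length xs ≡ (2 ^ suc m) ^ h →
           ∃ λ ys → Tree h ys × (∀ {y} → y ∈ ys → y ∈ xs)
    tree zero {x ∷ []} _ _ = x ∷ [] , leaf x , λ y∈ → y∈
    tree (suc h) {xs} xs! len
      with halve Fin.≤-total Fin.≤-trans (2 ^ m * s) (2 ^ m * s) xs! (trans len (double (2 ^ m) s))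
      where
      s = (2 ^ suc m) ^ h
      double : ∀ a s → 2 * a * s ≡ a * s + a * s
      double = solve-∀
    ... | ls , rs , ls! , rs! , lenls , lenrs , ls⊆ , rs⊆ , ls<rs , _
      with c , ls′ , rs′ , ls′! , rs′! , lenls′ , lenrs′ , ls′⊆ , rs′⊆ , sep ←
             separate m f ((2 ^ suc m) ^ h) {{m^n≢0 (2 ^ suc m) h {{m^n≢0 2 (suc m)}}}} ls! rs! lenls lenrs
      with us , l , us⊆ ← tree h ls′! lenls′
         | vs , r , vs⊆ ← tree h rs′! lenrs′
      = us ++ vs
      , node c l r (λ x∈ y∈ → let x≤y , x≢y = ls<rs (ls′⊆ (us⊆ x∈)) (rs′⊆ (vs⊆ y∈)) in
                              Fin.≤∧≢⇒< x≤y x≢y , sep (us⊆ x∈) (vs⊆ y∈))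
      , λ y∈ → [ ls⊆ ∘ ls′⊆ ∘ us⊆ , rs⊆ ∘ rs′⊆ ∘ vs⊆ ]′ (∈-++⁻ us y∈)

  module _ {ℓ m d N : ℕ} .{{_ : NonZero ℓ}} (m≡ : m ≡ 4 * (2 ^ ℓ * 2 ^ ℓ)) (d≡ : d ≡ 2 * (suc (2 * ℓ) * ℓ))
           (f : Fin m → Fin N → A) where

    private
      h = 3 * (suc m * d)
      instance
        d≢0 : NonZero d
        d≢0 = subst NonZero (sym d≡) (m*n≢0 2 (suc (2 * ℓ) * ℓ) {{_}} {{m*n≢0 (suc (2 * ℓ)) ℓ}})

    -- At least 2 ^ h words are admissible and fewer are light, so some admissible word prescribes
    -- `d` colours or more. Among these, `select-constant` finds ℓ levels with constant sign on `S`,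
    -- and `chain` the 2 ^ ℓ leaves that branch there.
    monotone-rows : ∀ {xs} → Unique xs → length xs ≡ (2 ^ suc m) ^ h →
      ∃ λ b → ∃₂ λ S zs → S ⊆ allFin m × 2 ^ ℓ ≤ length S ×
        (∀ {z} → z ∈ zs → z ∈ xs) × 2 ^ ℓ ≤ length zs ×
        AllPairs (λ x y → x <ᶠ y × All (λ k → Directed b (f k x) (f k y)) S) zs
    monotone-rows xs! len
      with ys , t , ys⊆ ← tree f h xs! len
      with w , adm , d≤ ←
             ∑ʷ-heavy f h d (admissible f t)
               (<-≤-trans (light-small f m d (length-boolVecs m)) (admissible-count f t))
      with b , ds , S , ds⊆ , lends , S⊆ , q≤ , const ←
             -- The word may have more than `d` colours, while the averaging requires an exact
             -- number.
             select-constant (λ c k → lookup c k) ℓ (take d (colours f w)) (allFin m)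
               (trans (length-take d (colours f w)) (trans (m≤n⇒m⊓n≡m d≤) d≡))
               (trans (length-tabulate {n = m} (λ i → i)) m≡)
      with zs , zs⊆ , pairs , lenzs ←
             chain f t w adm (⊆-trans ds⊆ (take-⊆ d (colours f w)))
               -- All signs are forgotten except those of the rows in `S`, where every colour in
               -- `ds` has the value `b`.
               {λ x y → x <ᶠ y × All (λ k → Directed b (f k x) (f k y)) S}
               (All.map (λ all _ _ (x<y , dir) → x<y ,
                 All.map (λ {k} eq → subst (λ b → Directed b (f k _) (f k _)) eq (dir k)) all) const)
      = b , S , zs , S⊆ , q≤ , (λ z∈ → ys⊆ (zs⊆ z∈))
      , ≤-reflexive (sym (trans lenzs (cong (2 ^_) lends))) , pairs

  -- Monotone columns on a common set of rows.

  Monotone : ∀ {n} → Bool → (Fin n → A) → Set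
  Monotone b g = ∀ {k l} → k <ᶠ l → Directed b (g k) (g l)

  -- Equal indices, on which `Monotone` is silent, are settled by reflexivity.
  monotone-family : ∀ {p n} b (g : Fin p → Fin n → A) → (∀ i → Monotone b (g i)) →
    (∀ i → MonotoneSeq O (g i)) × ((∀ i → NonDecreasing O (g i)) ⊎ (∀ i → NonIncreasing O (g i)))
  monotone-family true g mono = (λ i → inj₁ (nondec i)) , inj₁ nondec
    where
    nondec : ∀ i → NonDecreasing O (g i)
    nondec i k l k≤l with k Fin.≟ l
    ... | yes refl = ⊑-refl
    ... | no  k≢l  = mono i (Fin.≤∧≢⇒< k≤l k≢l)
  monotone-family false g mono = (λ i → inj₂ (noninc i)) , inj₂ noninc
    where
    noninc : ∀ i → NonIncreasing O (g i)
    noninc i k l k≤l with k Fin.≟ l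
    ... | yes refl = ⊑-refl
    ... | no  k≢l  = mono i (Fin.≤∧≢⇒< k≤l k≢l)

  monotone-subsequence : ∀ m {M} → 2 ^ (m + m) ≤ M → (g : Fin M → A) →
    ∃₂ λ b (ρ : Fin m → Fin M) → (∀ {k l} → k <ᶠ l → ρ k <ᶠ ρ l) × Monotone b (g ∘ ρ)
  monotone-subsequence m {M} le g
    with ramsey {P = λ x y → g x ⊑ g y} {Q = λ x y → g y ⊑ g x} (λ x y → ⊑-total (g x) (g y)) m m (allFin M)
           (≤-trans le (≤-reflexive (sym (length-tabulate {n = M} (λ i → i)))))
  ... | inj₁ (ys , ys⊆ , m≤ , pairs) =
    true , pick ys m≤ , AllPairs-pick m≤ (AllPairs-resp-⊆ ys⊆ (allFin-sorted M)) , AllPairs-pick m≤ pairs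
  ... | inj₂ (ys , ys⊆ , m≤ , pairs) =
    false , pick ys m≤ , AllPairs-pick m≤ (AllPairs-resp-⊆ ys⊆ (allFin-sorted M)) , AllPairs-pick m≤ pairs

  module _ {M N m : ℕ} (M≤N : M ≤ N) (mono≤ : 2 ^ (m + m) ≤ M) (B : Fin N → Fin N → A) where

    -- Only the first `M` rows are used, so the number M ^ m of candidates for `ρ` does not grow
    -- with `N`. That `ρ` is increasing belongs to the property because a code in `Fin (M ^ m)`
    -- decodes to an arbitrary map.
    MonotoneOn : Bool → (Fin m → Fin M) → Fin N → Set
    MonotoneOn b ρ j = (∀ {k l} → k <ᶠ l → ρ k <ᶠ ρ l) × Monotone b (λ k → B (inject≤ (ρ k) M≤N) j)

    MonotoneOn-cong : ∀ b {ρ σ j} → (∀ k → ρ k ≡ σ k) → MonotoneOn b ρ j → MonotoneOn b σ j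
    MonotoneOn-cong b {j = j} ρ≗σ (strict , mono) =
      (λ {k} {l} k<l → subst₂ _<ᶠ_ (ρ≗σ k) (ρ≗σ l) (strict k<l)) ,
      (λ {k} {l} k<l → subst₂ (λ x y → Directed b (B (inject≤ x M≤N) j) (B (inject≤ y M≤N) j))
                              (ρ≗σ k) (ρ≗σ l) (mono k<l))

    encode : ∀ j → ∃ λ (c : Fin (M ^ m)) → MonotoneOn true (finToFun c) j ⊎ MonotoneOn false (finToFun c) j
    encode j with monotone-subsequence m mono≤ (λ i → B (inject≤ i M≤N) j)
    ... | true  , ρ , mono = funToFin ρ ,
          inj₁ (MonotoneOn-cong true (λ k → sym (Fin.finToFun-funToFin ρ k)) mono)
    ... | false , ρ , mono = funToFin ρ ,
          inj₂ (MonotoneOn-cong false (λ k → sym (Fin.finToFun-funToFin ρ k)) mono)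

    -- The pigeonhole principle is applied to the row choices and then to the two directions. The
    -- result is cut to exactly `s` columns, as `tree` starts from an exact power.
    monotone-columns : ∀ s → M ^ m * (s + s) < N →
      ∃₂ λ b ρ → ∃ λ js → Unique js × length js ≡ s × All (MonotoneOn b ρ) js
    monotone-columns s lt
      with c , zs , zs⊆ , s+s< , mono ←
        pigeonhole (M ^ m) {λ c j → MonotoneOn true (finToFun c) j ⊎ MonotoneOn false (finToFun c) j} (s + s)
          (All.universal encode (allFin N)) (<-≤-trans lt (≤-reflexive (sym (length-tabulate {n = N} (λ i → i)))))
      with us , vs , us⊆ , vs⊆ , monoᵤ , monoᵥ , len ← dichotomy mono
      with <-split {s} (subst (s + s <_) (sym len) s+s<)
    ... | inj₁ s<us = true , finToFun c , take s us
                    , AllPairs-resp-⊆ (⊆-trans (take-⊆ s us) (⊆-trans us⊆ zs⊆)) (allFin⁺ N)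
                    , trans (length-take s us) (m≤n⇒m⊓n≡m (<⇒≤ s<us))
                    , All-resp-⊆ (take-⊆ s us) monoᵤ
    ... | inj₂ s<vs = false , finToFun c , take s vs
                    , AllPairs-resp-⊆ (⊆-trans (take-⊆ s vs) (⊆-trans vs⊆ zs⊆)) (allFin⁺ N)
                    , trans (length-take s vs) (m≤n⇒m⊓n≡m (<⇒≤ s<vs))
                    , All-resp-⊆ (take-⊆ s vs) monoᵥ

  -- Assembly of the submatrix and conclusion.

  assemble : ∀ {M N m n q} (M≤N : M ≤ N) (mono≤ : 2 ^ (m + m) ≤ M) (B : Matrix O N N) → 1 ≤ n → n ≤ q →
    ∀ b ρ {js} → All (MonotoneOn M≤N mono≤ B b ρ) js →
    ∀ b′ {S zs} → S ⊆ allFin m → q ≤ length S → (∀ {z} → z ∈ zs → z ∈ js) → q ≤ length zs →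
    AllPairs (λ x y → x <ᶠ y ×
      All (λ k → Directed b′ (B (inject≤ (ρ k) M≤N) x) (B (inject≤ (ρ k) M≤N) y)) S) zs →
    HasMonotoneSubmatrix O n B
  assemble {M} {N} {m} {n} M≤N mono≤ B 1≤n n≤q b ρ mono b′ {S} {zs} S⊆ q≤S zs⊆ q≤zs pairs =
    r , t
    -- That `ρ` is increasing is recorded with each column; the first one, which exists since 1 ≤ n,
    -- supplies it.
    , (λ k l k<l → inject≤-mono-< M≤N (proj₁ (column (fromℕ< 1≤n)) (rows< k<l)))
    , (λ k l k<l → proj₁ (columns k<l))
    , monotone-family b′ (λ k l → B (r k) (t l))
        (λ k k<l → All.lookup (proj₂ (columns k<l)) (∈-lookup (inject≤ k n≤S)))
    , monotone-family b (λ l k → B (r k) (t l)) (λ l k<k′ → proj₂ (column l) (rows< k<k′))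
    where
    n≤S = ≤-trans n≤q q≤S
    n≤zs = ≤-trans n≤q q≤zs
    k↦ : Fin n → Fin m
    k↦ = pick S n≤S
    t : Fin n → Fin N
    t = pick zs n≤zs
    r : Fin n → Fin N
    r k = inject≤ (ρ (k↦ k)) M≤N
    rows< : ∀ {k l} → k <ᶠ l → k↦ k <ᶠ k↦ l
    rows< = AllPairs-pick n≤S (AllPairs-resp-⊆ S⊆ (allFin-sorted m))
    columns : ∀ {k l} → k <ᶠ l → t k <ᶠ t l ×
      All (λ i → Directed b′ (B (inject≤ (ρ i) M≤N) (t k)) (B (inject≤ (ρ i) M≤N) (t l))) S
    columns = AllPairs-pick n≤zs pairs
    column : ∀ l → MonotoneOn M≤N mono≤ B b ρ (t l)
    column l = All.lookup mono (zs⊆ (∈-lookup (inject≤ l n≤zs)))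

  module _ {n ℓ m d s M N : ℕ} .{{_ : NonZero ℓ}} (1≤n : 1 ≤ n) (n≤q : n ≤ 2 ^ ℓ)
           (m≡ : m ≡ 4 * (2 ^ ℓ * 2 ^ ℓ)) (d≡ : d ≡ 2 * (suc (2 * ℓ) * ℓ))
           (s≡ : s ≡ (2 ^ suc m) ^ (3 * (suc m * d)))
           (M≤N : M ≤ N) (mono≤ : 2 ^ (m + m) ≤ M) (enough : M ^ m * (s + s) < N) where

    monotone-submatrix : (B : Matrix O N N) → HasMonotoneSubmatrix O n B
    monotone-submatrix B = rows-from (monotone-columns M≤N mono≤ B s enough)
      where
      rows-from : (∃₂ λ b ρ → ∃ λ js → Unique js × length js ≡ s × All (MonotoneOn M≤N mono≤ B b ρ) js) →
                  HasMonotoneSubmatrix O n B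
      rows-from (b , ρ , js , js! , lenjs , mono) =
        let b′ , S , zs , S⊆ , q≤S , zs⊆ , q≤zs , pairs =
              monotone-rows {ℓ} m≡ d≡ (λ k j → B (inject≤ (ρ k) M≤N) j) js! (trans lenjs s≡)
        in assemble M≤N mono≤ B 1≤n n≤q b ρ mono b′ S⊆ q≤S zs⊆ q≤zs pairs

  monotone-submatrix-exponent : ∀ {n ℓ N} .{{_ : NonZero ℓ}} → 1 ≤ n → n ≤ 2 ^ ℓ → 2 ^ exponent ℓ ≤ N →
    (B : Matrix O N N) → HasMonotoneSubmatrix O n B
  monotone-submatrix-exponent {n} {ℓ} {N} 1≤n n≤q large =
    monotone-submatrix {ℓ = ℓ} {m} {levels ℓ} 1≤n n≤q refl refl refl M≤N ≤-refl enough
    where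
    open ≤-Reasoning
    m = rows ℓ
    u = (m + m) * m
    h = 3 * (suc m * levels ℓ)
    v = suc m * h

    enough : (2 ^ (m + m)) ^ m * ((2 ^ suc m) ^ h + (2 ^ suc m) ^ h) < N
    enough = begin-strict
      (2 ^ (m + m)) ^ m * ((2 ^ suc m) ^ h + (2 ^ suc m) ^ h)
        ≡⟨ cong₂ (λ x y → x * (y + y)) (^-*-assoc 2 (m + m) m) (^-*-assoc 2 (suc m) h) ⟩
      2 ^ u * (2 ^ v + 2 ^ v)     ≡⟨ double (2 ^ u) (2 ^ v) ⟩
      2 * (2 ^ u * 2 ^ v)         ≡⟨ cong (2 *_) (^-distribˡ-+-* 2 u v) ⟨
      2 ^ suc (u + v)             <⟨ ^-monoʳ-< 2 (s≤s (s≤s z≤n)) (n<1+n (suc (u + v))) ⟩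
      2 ^ suc (suc (u + v))       ≤⟨ large ⟩
      N                           ∎
      where
      double : ∀ x y → x * (y + y) ≡ 2 * (x * y)
      double = solve-∀

    instance
      m≢0 : NonZero m
      m≢0 = m*n≢0 4 (2 ^ ℓ * 2 ^ ℓ) {{_}} {{m*n≢0 (2 ^ ℓ) (2 ^ ℓ) {{m^n≢0 2 ℓ}} {{m^n≢0 2 ℓ}}}}

    M≤N : 2 ^ (m + m) ≤ N
    M≤N = ≤-trans (^-monoʳ-≤ 2 (begin
      m + m            ≤⟨ m≤m*n (m + m) m ⟩
      u                ≤⟨ m≤n+m u 2 ⟩
      2 + u            ≤⟨ m≤m+n (2 + u) v ⟩
      exponent ℓ       ∎)) large

theorem1 : Σ ℕ λ c → 0 < c ×
    ((T : TotalOrder 0ℓ 0ℓ 0ℓ) → (n : ℕ) → 1 ≤ n → (N : ℕ) →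
    2 ^ (c * n ^ 4 * ⌈log₂ n ⌉ ^ 2) ≤ N →
    (A : Matrix T N N) → HasMonotoneSubmatrix T n A)
theorem1 = 5716 , z<s , main
  where
  main : (T : TotalOrder 0ℓ 0ℓ 0ℓ) → (n : ℕ) → 1 ≤ n → (N : ℕ) →
    2 ^ (5716 * n ^ 4 * ⌈log₂ n ⌉ ^ 2) ≤ N →
    (A : Matrix T N N) → HasMonotoneSubmatrix T n A
  -- For n = 1 the logarithm is 0 and the hypothesis reads 1 ≤ N; a single entry is monotone. The
  -- general argument needs a nonzero logarithm.
  main T 1 _ (suc N) _ A =
    (λ _ → zero) , (λ _ → zero) , (λ { zero zero () }) , (λ { zero zero () }) ,
    entry , entry
    where
    ≤-refl-T = TotalOrder.refl T {A zero zero}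
    entry = (λ { zero → inj₁ λ { zero zero _ → ≤-refl-T } }) , inj₁ λ { zero zero zero _ → ≤-refl-T }
  main T 1 _ zero le A = contradiction le (<⇒≱ z<s)
  main T n@(suc (suc _)) 1≤n N le A =
    TotallyOrdered.monotone-submatrix-exponent T {ℓ = ⌈log₂ n ⌉} {{>-nonZero 1≤ℓ}} 1≤n (n≤2^⌈log₂n⌉ n)
      (≤-trans (^-monoʳ-≤ 2 (exponent-bound n ⌈log₂ n ⌉ 1≤n 1≤ℓ (2^⌈log₂n⌉≤2n n))) le) A
    where
    1≤ℓ : 1 ≤ ⌈log₂ n ⌉
    1≤ℓ = ⌈log₂⌉-mono-≤ {2} {n} (s≤s (s≤s z≤n))
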